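{- There exists an integer $n_0$ such that for every $n \ge n_0$ the following holds. If $(\mathcal{F},\mathcal{G})$ is a cross-Sperner pair of families with $\emptyset \neq \mathcal{F}, \mathcal{G} \subseteq 2^{[n]}$ (i.e. both families are non-empty), then $$|\mathcal{F}|+|\mathcal{G}| \le F(n,1)+1 = 2^n-2^{\lceil n/2\rceil}-2^{\lfloor n/2\rfloor}+2,$$ and equality $|\mathcal{F}|+|\mathcal{G}| = F(n,1)+1$ holds if and only if one of the families $\mathcal{F}$, $\mathcal{G}$ consists of exactly one set $S$ of size $\lfloor n/2 \rfloor$ or $\lceil n/2 \rceil$ and the other family consists of all subsets of $[n]$ not contained in $S$ and not containing $S$.
   Context: $[n]=\{1,\dots,n\}$ and $2^{[n]}$ is its power set. A pair $(\mathcal{F},\mathcal{G})$ of families of sets is cross-Sperner if there exists no pair of sets $F \in \mathcal{F}$, $G \in \mathcal{G}$ with $F \subseteq G$ or $G \subseteq F$ (in particular $\mathcal{F}\cap\mathcal{G}=\emptyset$). Define $$F(n,m)=\max\{|\mathcal{G}| : \mathcal{G} \subseteq 2^{[n]},\ \exists\, \mathcal{F} \subseteq 2^{[n]} \text{ with } |\mathcal{F}|=m \text{ and } (\mathcal{F},\mathcal{G}) \text{ cross-Sperner}\}.$$ -}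

module Defs where

open import Data.Bool.Base using (Bool; T)
open import Data.Fin.Subset using (Subset; inside; outside; ∣_∣; _⊆_; _⊈_)
open import Data.List.Base using (List; []; _∷_; _++_; map; filterᵇ; length)
open import Data.Nat.Base using (ℕ; zero; suc; _≤_; ⌊_/2⌋; ⌈_/2⌉)
open import Data.Product.Base using (∃; ∃₂; _×_)
open import Data.Sum.Base using (_⊎_)
open import Data.Vec.Base using ([]; _∷_)
open import Function.Bundles using (_⇔_)
open import Relation.Binary.PropositionalEquality.Core using (_≡_)
open import Relation.Nullary.Negation.Core using (¬_)

-- A family of subsets of [n], given by its characteristic function.
-- Families are compared extensionally, through _∈ᶠ_, never through _≡_.
Family : ℕ → Set
Family n = Subset n → Bool

infix 4 _∈ᶠ_

_∈ᶠ_ : ∀ {n} → Subset n → Family n → Set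
A ∈ᶠ ℱ = T (ℱ A)

NonemptyFamily : ∀ {n} → Family n → Set
NonemptyFamily ℱ = ∃ λ A → A ∈ᶠ ℱ

-- Every subset of [n] is listed exactly once.
subsets : ∀ n → List (Subset n)
subsets zero    = [] ∷ []
subsets (suc n) = map (outside ∷_) (subsets n) ++ map (inside ∷_) (subsets n)

∣_∣ᶠ : ∀ {n} → Family n → ℕ
∣_∣ᶠ {n} ℱ = length (filterᵇ ℱ (subsets n))

CrossSperner : ∀ {n} → Family n → Family n → Set
CrossSperner ℱ 𝒢 = ¬ (∃₂ λ A B → A ∈ᶠ ℱ × B ∈ᶠ 𝒢 × (A ⊆ B ⊎ B ⊆ A))

IsMaximum : (ℕ → Set) → ℕ → Set
IsMaximum P k = P k × (∀ j → P j → j ≤ k)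

-- IsF n m k says that F(n,m) is defined and equal to k.  A relation is used
-- because for m > 2ⁿ the maximum is over an empty set.
IsF : ℕ → ℕ → ℕ → Set
IsF n m = IsMaximum λ k →
  ∃ λ (𝒢 : Family n) → ∣ 𝒢 ∣ᶠ ≡ k ×
    (∃ λ (ℱ : Family n) → ∣ ℱ ∣ᶠ ≡ m × CrossSperner ℱ 𝒢)

-- ℱ = {S} with S of size ⌊n/2⌋ or ⌈n/2⌉, and 𝒢 consists of all sets
-- incomparable to S.
MiddleSetAndIncomparables : ∀ {n} → Family n → Family n → Set
MiddleSetAndIncomparables {n} ℱ 𝒢 = ∃ λ (S : Subset n) →
  (∣ S ∣ ≡ ⌊ n /2⌋ ⊎ ∣ S ∣ ≡ ⌈ n /2⌉) ×
  (∀ A → A ∈ᶠ ℱ ⇔ A ≡ S) ×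
  (∀ B → B ∈ᶠ 𝒢 ⇔ (B ⊈ S × S ⊈ B))

module Submission where

-- Let U, D and U′, D′ be the up- and down-closures of ℱ and 𝒢, write f, g for
-- the cardinalities of the two families, N = 2ⁿ, and P = 2^⌊n/2⌋ + 2^⌈n/2⌉.
-- The families ℱ, 𝒢, U ∩ U′ and D ∩ D′ are pairwise disjoint.  Harris'
-- inequality gives N |U ∩ U′| ≥ |U| g, N |D ∩ D′| ≥ |D| g and
-- N f ≤ N |U ∩ D| ≤ |U| |D|.  Hence, if f + g + P ≥ N, then (|U| + |D|) g ≤ N P,
-- and by AM-GM 4 f g² ≤ N P² ≤ (9/2) N².  If f ≤ g, then g is at least N/2 − P/2,
-- so f is bounded; then g is close to N, and f ≤ 9/8 + o(1) forces f = 1.  For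
-- ℱ = {S} one counts the sets comparable to S: 2^|S| + 2^(n−|S|) − 1 of them.

open import Defs
open import Data.Bool.Base using (T; true; false; not; _∧_; _∨_)
open import Data.Bool.Properties as Bool using (T-∧; T-∨)
open import Data.Empty using (⊥-elim)
open import Data.Fin.Subset using (Subset; inside; outside; ∣_∣; _⊆_; _⊈_; ∁; ⊥)
open import Data.Fin.Subset.Properties
  using (_⊆?_; anySubset?; ⊆-refl; ⊆-trans; ⊆-antisym; out⊆; s⊆s; ∣p∣≤n; ∣⊥∣≡0; ∣∁p∣≡n∸∣p∣)
import Data.Integer.Base as ℤ
import Data.Integer.Tactic.RingSolver as ℤ-Solver
open import Data.List.Base using ([]; _∷_; map; filterᵇ; length)
open import Data.List.Properties using (filter-++; length-++)
open import Data.Nat.Base using (ℕ; zero; suc; _+_; _*_; _^_; _≤_; _<_; _≥_; z≤n; s≤s; ⌊_/2⌋; ⌈_/2⌉)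
open import Data.Nat.Properties
open import Data.Nat.Tactic.RingSolver using (solve-∀)
open import Data.Product.Base using (∃; _×_; _,_; proj₁; proj₂)
open import Data.Sum.Base using (_⊎_; inj₁; inj₂; [_,_]′; swap)
open import Data.Vec.Base using ([]; _∷_)
open import Data.Vec.Properties using (≡-dec)
open import Function.Base using (_∘_; id)
open import Function.Bundles using (_⇔_; mk⇔; Equivalence)
open import Relation.Binary.Definitions using (tri<; tri≈; tri>)
open import Relation.Binary.PropositionalEquality
  using (_≡_; refl; sym; trans; cong; cong₂; subst)
open import Relation.Nullary.Decidable.Core
  using (Dec; yes; no; T?; does; ⌊_⌋; toWitness; fromWitness; _×-dec_)
open import Relation.Nullary.Negation.Core using (¬_; contradiction)

open Equivalence using (to; from)

-- Families of sets and their cardinalities.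

variable
  n : ℕ

infixr 7 _∩ᶠ_
infixr 6 _∪ᶠ_

_∩ᶠ_ _∪ᶠ_ : Family n → Family n → Family n
(ℱ ∩ᶠ 𝒢) A = ℱ A ∧ 𝒢 A
(ℱ ∪ᶠ 𝒢) A = ℱ A ∨ 𝒢 A

∁ᶠ : Family n → Family n
∁ᶠ ℱ A = not (ℱ A)

_⊆ᶠ_ : Family n → Family n → Set
ℱ ⊆ᶠ 𝒢 = ∀ {A} → A ∈ᶠ ℱ → A ∈ᶠ 𝒢

Disjoint : Family n → Family n → Set
Disjoint ℱ 𝒢 = ∀ {A} → A ∈ᶠ ℱ → ¬ A ∈ᶠ 𝒢

∈-∁ᶠ⁻ : (ℱ : Family n) {A : Subset n} → A ∈ᶠ ∁ᶠ ℱ → ¬ A ∈ᶠ ℱ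
∈-∁ᶠ⁻ ℱ {A} p with ℱ A
... | false = λ ()

∈-∁ᶠ⁺ : (ℱ : Family n) {A : Subset n} → ¬ A ∈ᶠ ℱ → A ∈ᶠ ∁ᶠ ℱ
∈-∁ᶠ⁺ ℱ {A} p with ℱ A
... | false = _
... | true  = p _

length-filterᵇ-map : ∀ {A B : Set} (p : B → _) (h : A → B) xs →
  length (filterᵇ p (map h xs)) ≡ length (filterᵇ (p ∘ h) xs)
length-filterᵇ-map p h []       = refl
length-filterᵇ-map p h (x ∷ xs) with p (h x)
... | true  = cong suc (length-filterᵇ-map p h xs)
... | false = length-filterᵇ-map p h xs

-- Sorting the sets by their first element makes induction on `n` available for every count below.
card-suc : (ℱ : Family (suc n)) →
  ∣ ℱ ∣ᶠ ≡ ∣ ℱ ∘ (outside ∷_) ∣ᶠ + ∣ ℱ ∘ (inside ∷_) ∣ᶠ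
card-suc {n} ℱ = trans
  (cong length (filter-++ (T? ∘ ℱ) (map (outside ∷_) (subsets n)) _))
  (trans (length-++ (filterᵇ ℱ (map (outside ∷_) (subsets n))))
    (cong₂ _+_ (length-filterᵇ-map ℱ _ (subsets n)) (length-filterᵇ-map ℱ _ (subsets n))))

card-mono : {ℱ 𝒢 : Family n} → ℱ ⊆ᶠ 𝒢 → ∣ ℱ ∣ᶠ ≤ ∣ 𝒢 ∣ᶠ
card-mono {zero} {ℱ} {𝒢} sub with ℱ [] | 𝒢 [] | sub {[]}
... | false | _     | _ = z≤n
... | true  | true  | _ = ≤-refl
... | true  | false | p = ⊥-elim (p _)
card-mono {suc n} {ℱ} {𝒢} sub rewrite card-suc ℱ | card-suc 𝒢 =
  +-mono-≤ (card-mono {ℱ = ℱ ∘ (outside ∷_)} sub) (card-mono {ℱ = ℱ ∘ (inside ∷_)} sub)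

card-cong : {ℱ 𝒢 : Family n} → ℱ ⊆ᶠ 𝒢 → 𝒢 ⊆ᶠ ℱ → ∣ ℱ ∣ᶠ ≡ ∣ 𝒢 ∣ᶠ
card-cong {ℱ = ℱ} {𝒢} p q = ≤-antisym (card-mono {ℱ = ℱ} {𝒢} p) (card-mono {ℱ = 𝒢} {ℱ} q)

+-interchange : ∀ a b c d → (a + b) + (c + d) ≡ (a + c) + (b + d)
+-interchange = solve-∀

-- Inclusion-exclusion in additive form, which avoids truncated subtraction.
card-∪+card-∩ : (ℱ 𝒢 : Family n) → ∣ ℱ ∪ᶠ 𝒢 ∣ᶠ + ∣ ℱ ∩ᶠ 𝒢 ∣ᶠ ≡ ∣ ℱ ∣ᶠ + ∣ 𝒢 ∣ᶠ
card-∪+card-∩ {zero} ℱ 𝒢 with ℱ [] | 𝒢 []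
... | false | false = refl
... | false | true  = refl
... | true  | false = refl
... | true  | true  = refl
card-∪+card-∩ {suc n} ℱ 𝒢
  rewrite card-suc (ℱ ∪ᶠ 𝒢) | card-suc (ℱ ∩ᶠ 𝒢) | card-suc ℱ | card-suc 𝒢 = trans
  (+-interchange ∣ (ℱ ∪ᶠ 𝒢) ∘ (outside ∷_) ∣ᶠ _ _ _)
  (trans (cong₂ _+_ (card-∪+card-∩ (ℱ ∘ (outside ∷_)) (𝒢 ∘ (outside ∷_)))
                    (card-∪+card-∩ (ℱ ∘ (inside ∷_)) (𝒢 ∘ (inside ∷_))))
    (+-interchange ∣ ℱ ∘ (outside ∷_) ∣ᶠ _ _ _))

card-empty : ∣ (λ (_ : Subset n) → false) ∣ᶠ ≡ 0
card-empty {zero}  = refl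
card-empty {suc n} rewrite card-suc {n} (λ _ → false) | card-empty {n} = refl

card≡0 : (ℱ : Family n) → (∀ A → ¬ A ∈ᶠ ℱ) → ∣ ℱ ∣ᶠ ≡ 0
card≡0 {n} ℱ empty = trans (card-cong {ℱ = ℱ} {λ _ → false} (λ {A} → empty A) λ ()) (card-empty {n})

card-∪-disjoint : (ℱ 𝒢 : Family n) → Disjoint ℱ 𝒢 → ∣ ℱ ∪ᶠ 𝒢 ∣ᶠ ≡ ∣ ℱ ∣ᶠ + ∣ 𝒢 ∣ᶠ
card-∪-disjoint ℱ 𝒢 dis = trans (sym (+-identityʳ _))
  (trans (cong (∣ ℱ ∪ᶠ 𝒢 ∣ᶠ +_) (sym (card≡0 (ℱ ∩ᶠ 𝒢) λ A p → dis (proj₁ (to T-∧ p)) (proj₂ (to T-∧ p)))))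
    (card-∪+card-∩ ℱ 𝒢))

card-full : ∣ (λ (_ : Subset n) → true) ∣ᶠ ≡ 2 ^ n
card-full {zero}  = refl
card-full {suc n} rewrite card-suc {n} (λ _ → true) | card-full {n} | +-identityʳ (2 ^ n) = refl

card≤2^n : (ℱ : Family n) → ∣ ℱ ∣ᶠ ≤ 2 ^ n
card≤2^n {n} ℱ = subst (∣ ℱ ∣ᶠ ≤_) (card-full {n}) (card-mono {ℱ = ℱ} _)

card-+-∁ : (ℱ : Family n) → ∣ ℱ ∣ᶠ + ∣ ∁ᶠ ℱ ∣ᶠ ≡ 2 ^ n
card-+-∁ {n} ℱ = trans (sym (card-∪-disjoint ℱ (∁ᶠ ℱ) (λ p q → ∈-∁ᶠ⁻ ℱ q p)))
  (trans (card-cong {ℱ = ℱ ∪ᶠ ∁ᶠ ℱ} _ (λ {A} _ → total A)) (card-full {n}))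
  where
  total : ∀ A → A ∈ᶠ (ℱ ∪ᶠ ∁ᶠ ℱ)
  total A with ℱ A
  ... | true  = _
  ... | false = _

card-∩-+-∩∁ : (ℱ 𝒢 : Family n) → ∣ ℱ ∩ᶠ 𝒢 ∣ᶠ + ∣ ℱ ∩ᶠ ∁ᶠ 𝒢 ∣ᶠ ≡ ∣ ℱ ∣ᶠ
card-∩-+-∩∁ ℱ 𝒢 = trans (sym (card-∪-disjoint (ℱ ∩ᶠ 𝒢) (ℱ ∩ᶠ ∁ᶠ 𝒢) dis)) (card-cong {ℱ = (ℱ ∩ᶠ 𝒢) ∪ᶠ (ℱ ∩ᶠ ∁ᶠ 𝒢)} {ℱ} (λ {A} → ⊆ A) (λ {A} → ⊇ A))
  where
  dis : Disjoint (ℱ ∩ᶠ 𝒢) (ℱ ∩ᶠ ∁ᶠ 𝒢)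
  dis p q = ∈-∁ᶠ⁻ 𝒢 (proj₂ (to T-∧ q)) (proj₂ (to T-∧ p))
  ⊆ : ∀ A → A ∈ᶠ (ℱ ∩ᶠ 𝒢) ∪ᶠ (ℱ ∩ᶠ ∁ᶠ 𝒢) → A ∈ᶠ ℱ
  ⊆ A with ℱ A
  ... | true  = _
  ... | false = id
  ⊇ : ∀ A → A ∈ᶠ ℱ → A ∈ᶠ (ℱ ∩ᶠ 𝒢) ∪ᶠ (ℱ ∩ᶠ ∁ᶠ 𝒢)
  ⊇ A p with ℱ A | 𝒢 A
  ... | true | true  = _
  ... | true | false = _

nonempty⇒card>0 : (ℱ : Family n) → NonemptyFamily ℱ → 0 < ∣ ℱ ∣ᶠ
nonempty⇒card>0 ℱ ([] , p) with ℱ []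
... | true = s≤s z≤n
nonempty⇒card>0 ℱ (outside ∷ A , p) rewrite card-suc ℱ =
  m≤n⇒m≤n+o _ (nonempty⇒card>0 (ℱ ∘ (outside ∷_)) (A , p))
nonempty⇒card>0 ℱ (inside ∷ A , p) rewrite card-suc ℱ =
  m≤n⇒m≤o+n ∣ ℱ ∘ (outside ∷_) ∣ᶠ (nonempty⇒card>0 (ℱ ∘ (inside ∷_)) (A , p))

card>0⇒nonempty : (ℱ : Family n) → 0 < ∣ ℱ ∣ᶠ → NonemptyFamily ℱ
card>0⇒nonempty ℱ pos with anySubset? (T? ∘ ℱ)
... | yes nonempty = nonempty
... | no  empty    = contradiction (card≡0 ℱ λ A p → empty (A , p)) (>⇒≢ pos)

-- Correlation of up-closed and down-closed families.

UpClosed DownClosed : Family n → Set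
UpClosed   ℱ = ∀ {A B} → A ⊆ B → A ∈ᶠ ℱ → B ∈ᶠ ℱ
DownClosed ℱ = ∀ {A B} → A ⊆ B → B ∈ᶠ ℱ → A ∈ᶠ ℱ

∁-upClosed : (ℱ : Family n) → UpClosed ℱ → DownClosed (∁ᶠ ℱ)
∁-upClosed ℱ up A⊆B B∉ℱ = ∈-∁ᶠ⁺ ℱ (∈-∁ᶠ⁻ ℱ B∉ℱ ∘ up A⊆B)

∁-downClosed : (ℱ : Family n) → DownClosed ℱ → UpClosed (∁ᶠ ℱ)
∁-downClosed ℱ down A⊆B A∉ℱ = ∈-∁ᶠ⁺ ℱ (∈-∁ᶠ⁻ ℱ A∉ℱ ∘ down A⊆B)

-- Chebyshev's sum inequality for two oppositely ordered pairs: the sides differ by `k * l`, the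
-- product of the two gaps.
rearrangement : ∀ {a₀ a₁ b₀ b₁} → a₀ ≤ a₁ → b₁ ≤ b₀ →
  2 * (a₀ * b₀ + a₁ * b₁) ≤ (a₀ + a₁) * (b₀ + b₁)
rearrangement {a₀} {a₁} {b₀} {b₁} a₀≤a₁ b₁≤b₀
  with k , refl ← m≤n⇒∃[o]m+o≡n a₀≤a₁ | l , refl ← m≤n⇒∃[o]m+o≡n b₁≤b₀ =
  subst (2 * (a₀ * (b₁ + l) + (a₀ + k) * b₁) ≤_) (sym (expand a₀ b₁ k l)) (m≤m+n _ (k * l))
  where
  expand : ∀ a b k l →
    (a + (a + k)) * ((b + l) + b) ≡ 2 * (a * (b + l) + (a + k) * b) + k * l
  expand = solve-∀

-- Harris' inequality, by induction on n: the two halves of 𝒰 and of 𝒟 are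
-- ordered oppositely.
card-up∩down : {𝒰 𝒟 : Family n} → UpClosed 𝒰 → DownClosed 𝒟 →
  2 ^ n * ∣ 𝒰 ∩ᶠ 𝒟 ∣ᶠ ≤ ∣ 𝒰 ∣ᶠ * ∣ 𝒟 ∣ᶠ
card-up∩down {zero} {𝒰} {𝒟} _ _ with 𝒰 [] | 𝒟 []
... | false | _     = z≤n
... | true  | true  = ≤-refl
... | true  | false = z≤n
card-up∩down {suc n} {𝒰} {𝒟} up down
  rewrite card-suc 𝒰 | card-suc 𝒟 | card-suc (𝒰 ∩ᶠ 𝒟) = begin
  2 * 2 ^ n * (x₀ + x₁)             ≡⟨ distrib (2 ^ n) x₀ x₁ ⟩
  2 * (2 ^ n * x₀ + 2 ^ n * x₁)     ≤⟨ *-monoʳ-≤ 2 (+-mono-≤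
                                         (card-up∩down {𝒰 = 𝒰 ∘ (outside ∷_)} {𝒟 ∘ (outside ∷_)} (up ∘ s⊆s) (down ∘ s⊆s))
                                         (card-up∩down {𝒰 = 𝒰 ∘ (inside ∷_)} {𝒟 ∘ (inside ∷_)} (up ∘ s⊆s) (down ∘ s⊆s))) ⟩
  2 * (u₀ * d₀ + u₁ * d₁)           ≤⟨ rearrangement
                                         (card-mono {ℱ = 𝒰 ∘ (outside ∷_)} {𝒰 ∘ (inside ∷_)} (up (out⊆ ⊆-refl)))
                                         (card-mono {ℱ = 𝒟 ∘ (inside ∷_)} {𝒟 ∘ (outside ∷_)} (down (out⊆ ⊆-refl))) ⟩
  (u₀ + u₁) * (d₀ + d₁)             ∎
  where
  open ≤-Reasoning
  u₀ = ∣ 𝒰 ∘ (outside ∷_) ∣ᶠ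
  u₁ = ∣ 𝒰 ∘ (inside ∷_) ∣ᶠ
  d₀ = ∣ 𝒟 ∘ (outside ∷_) ∣ᶠ
  d₁ = ∣ 𝒟 ∘ (inside ∷_) ∣ᶠ
  x₀ = ∣ (𝒰 ∩ᶠ 𝒟) ∘ (outside ∷_) ∣ᶠ
  x₁ = ∣ (𝒰 ∩ᶠ 𝒟) ∘ (inside ∷_) ∣ᶠ
  distrib : ∀ N x y → 2 * N * (x + y) ≡ 2 * (N * x + N * y)
  distrib = solve-∀

-- Both a b + a b′ and N x + N x′ equal a N, so an upper bound on N x′ turns into a lower bound on N
-- x. This carries Harris' inequality from a family to its complement.
complement-product : ∀ {N a b b′ x x′} → b + b′ ≡ N → x + x′ ≡ a →
  N * x′ ≤ a * b′ → a * b ≤ N * x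
complement-product {b = b} {b′} {x} {x′} refl refl le =
  +-cancelʳ-≤ ((x + x′) * b′) _ _ (begin
    (x + x′) * b + (x + x′) * b′         ≡⟨ expand b b′ x x′ ⟩
    (b + b′) * x + (b + b′) * x′         ≤⟨ +-monoʳ-≤ ((b + b′) * x) le ⟩
    (b + b′) * x + (x + x′) * b′         ∎)
  where
  open ≤-Reasoning
  expand : ∀ b b′ x x′ → (x + x′) * b + (x + x′) * b′ ≡ (b + b′) * x + (b + b′) * x′
  expand = solve-∀

-- The complement of `𝒱` is down-closed, hence negatively correlated with `𝒰`.
card-up∩up : (𝒰 𝒱 : Family n) → UpClosed 𝒰 → UpClosed 𝒱 →
  ∣ 𝒰 ∣ᶠ * ∣ 𝒱 ∣ᶠ ≤ 2 ^ n * ∣ 𝒰 ∩ᶠ 𝒱 ∣ᶠ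
card-up∩up 𝒰 𝒱 up-𝒰 up-𝒱 =
  complement-product {x = ∣ 𝒰 ∩ᶠ 𝒱 ∣ᶠ} (card-+-∁ 𝒱) (card-∩-+-∩∁ 𝒰 𝒱)
    (card-up∩down {𝒰 = 𝒰} {∁ᶠ 𝒱} up-𝒰 (∁-upClosed 𝒱 up-𝒱))

card-down∩down : (𝒟 ℰ : Family n) → DownClosed 𝒟 → DownClosed ℰ →
  ∣ 𝒟 ∣ᶠ * ∣ ℰ ∣ᶠ ≤ 2 ^ n * ∣ 𝒟 ∩ᶠ ℰ ∣ᶠ
card-down∩down {n} 𝒟 ℰ down-𝒟 down-ℰ =
  complement-product {x = ∣ 𝒟 ∩ᶠ ℰ ∣ᶠ} (card-+-∁ ℰ) (card-∩-+-∩∁ 𝒟 ℰ) (begin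
    -- Here the complement is the up-closed factor, which `card-up∩down` expects first.
    2 ^ n * ∣ 𝒟 ∩ᶠ ∁ᶠ ℰ ∣ᶠ     ≤⟨ *-monoʳ-≤ (2 ^ n) (card-mono {ℱ = 𝒟 ∩ᶠ ∁ᶠ ℰ} {∁ᶠ ℰ ∩ᶠ 𝒟} (λ {A} → subst T (Bool.∧-comm (𝒟 A) _))) ⟩
    2 ^ n * ∣ ∁ᶠ ℰ ∩ᶠ 𝒟 ∣ᶠ     ≤⟨ card-up∩down {𝒰 = ∁ᶠ ℰ} {𝒟} (∁-downClosed ℰ down-ℰ) down-𝒟 ⟩
    ∣ ∁ᶠ ℰ ∣ᶠ * ∣ 𝒟 ∣ᶠ         ≡⟨ *-comm ∣ ∁ᶠ ℰ ∣ᶠ _ ⟩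
    ∣ 𝒟 ∣ᶠ * ∣ ∁ᶠ ℰ ∣ᶠ         ∎)
  where open ≤-Reasoning

-- Closures of the two families of a cross-Sperner pair.

upClosure downClosure : Family n → Family n
upClosure   ℱ A = ⌊ anySubset? (λ B → T? (ℱ B) ×-dec (B ⊆? A)) ⌋
downClosure ℱ A = ⌊ anySubset? (λ B → T? (ℱ B) ×-dec (A ⊆? B)) ⌋

∈-upClosure⁺ : (ℱ : Family n) {A B : Subset n} → B ∈ᶠ ℱ → B ⊆ A → A ∈ᶠ upClosure ℱ
∈-upClosure⁺ ℱ {A} B∈ℱ B⊆A =
  fromWitness {a? = anySubset? (λ B → T? (ℱ B) ×-dec (B ⊆? A))} (_ , B∈ℱ , B⊆A)

∈-upClosure⁻ : (ℱ : Family n) {A : Subset n} → A ∈ᶠ upClosure ℱ → ∃ λ B → B ∈ᶠ ℱ × B ⊆ A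
∈-upClosure⁻ ℱ = toWitness

∈-downClosure⁺ : (ℱ : Family n) {A B : Subset n} → B ∈ᶠ ℱ → A ⊆ B → A ∈ᶠ downClosure ℱ
∈-downClosure⁺ ℱ {A} B∈ℱ A⊆B =
  fromWitness {a? = anySubset? (λ B → T? (ℱ B) ×-dec (A ⊆? B))} (_ , B∈ℱ , A⊆B)

∈-downClosure⁻ : (ℱ : Family n) {A : Subset n} → A ∈ᶠ downClosure ℱ → ∃ λ B → B ∈ᶠ ℱ × A ⊆ B
∈-downClosure⁻ ℱ = toWitness

upClosure-upClosed : (ℱ : Family n) → UpClosed (upClosure ℱ)
upClosure-upClosed ℱ {A} {B} A⊆B p with C , C∈ℱ , C⊆A ← ∈-upClosure⁻ ℱ p =
  ∈-upClosure⁺ ℱ C∈ℱ (⊆-trans {i = C} {A} {B} C⊆A A⊆B)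

downClosure-downClosed : (ℱ : Family n) → DownClosed (downClosure ℱ)
downClosure-downClosed ℱ {A} {B} A⊆B p with C , C∈ℱ , B⊆C ← ∈-downClosure⁻ ℱ p =
  ∈-downClosure⁺ ℱ C∈ℱ (⊆-trans {i = A} {B} {C} A⊆B B⊆C)

⊆-upClosure : (ℱ : Family n) → ℱ ⊆ᶠ upClosure ℱ
⊆-upClosure ℱ {A} A∈ℱ = ∈-upClosure⁺ ℱ A∈ℱ (⊆-refl {x = A})

⊆-downClosure : (ℱ : Family n) → ℱ ⊆ᶠ downClosure ℱ
⊆-downClosure ℱ {A} A∈ℱ = ∈-downClosure⁺ ℱ A∈ℱ (⊆-refl {x = A})

crossSperner-sym : {ℱ 𝒢 : Family n} → CrossSperner ℱ 𝒢 → CrossSperner 𝒢 ℱ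
crossSperner-sym sep (A , B , A∈𝒢 , B∈ℱ , cmp) = sep (B , A , B∈ℱ , A∈𝒢 , swap cmp)

disjoint-∪ : (ℱ 𝒢 ℋ : Family n) → Disjoint ℱ 𝒢 → Disjoint ℱ ℋ → Disjoint ℱ (𝒢 ∪ᶠ ℋ)
disjoint-∪ ℱ 𝒢 ℋ d e p q = [ d p , e p ]′ (to T-∨ q)

module _ (ℱ 𝒢 : Family n) (sep : CrossSperner ℱ 𝒢) where

  private
    𝒰 = upClosure ℱ ∩ᶠ upClosure 𝒢
    𝒟 = downClosure ℱ ∩ᶠ downClosure 𝒢

    disjoint-ℱ-𝒢 : Disjoint ℱ 𝒢
    disjoint-ℱ-𝒢 {A} p q = sep (A , A , p , q , inj₁ (⊆-refl {x = A}))

    disjoint-ℱ-𝒰 : Disjoint ℱ 𝒰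
    disjoint-ℱ-𝒰 {A} p q with B , B∈𝒢 , B⊆A ← ∈-upClosure⁻ 𝒢 (proj₂ (to T-∧ q)) =
      sep (A , B , p , B∈𝒢 , inj₂ B⊆A)

    disjoint-ℱ-𝒟 : Disjoint ℱ 𝒟
    disjoint-ℱ-𝒟 {A} p q with B , B∈𝒢 , A⊆B ← ∈-downClosure⁻ 𝒢 (proj₂ (to T-∧ q)) =
      sep (A , B , p , B∈𝒢 , inj₁ A⊆B)

    disjoint-𝒢-𝒰 : Disjoint 𝒢 𝒰
    disjoint-𝒢-𝒰 {A} p q with B , B∈ℱ , B⊆A ← ∈-upClosure⁻ ℱ (proj₁ (to T-∧ q)) =
      sep (B , A , B∈ℱ , p , inj₁ B⊆A)

    disjoint-𝒢-𝒟 : Disjoint 𝒢 𝒟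
    disjoint-𝒢-𝒟 {A} p q with B , B∈ℱ , A⊆B ← ∈-downClosure⁻ ℱ (proj₁ (to T-∧ q)) =
      sep (B , A , B∈ℱ , p , inj₂ A⊆B)

    -- A common member would contain a member of `ℱ` and be contained in a member of `𝒢`, making
    -- these two comparable.
    disjoint-𝒰-𝒟 : Disjoint 𝒰 𝒟
    disjoint-𝒰-𝒟 {C} p q
      with A , A∈ℱ , A⊆C ← ∈-upClosure⁻ ℱ (proj₁ (to T-∧ p))
         | B , B∈𝒢 , C⊆B ← ∈-downClosure⁻ 𝒢 (proj₂ (to T-∧ q)) =
      sep (A , B , A∈ℱ , B∈𝒢 , inj₁ (⊆-trans {i = A} {C} {B} A⊆C C⊆B))

  -- A set in `𝒰` or `𝒟` is comparable to members of both families, so it lies in neither: these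
  -- sets are lost to the pair.
  crossSperner-card-bound : ∣ ℱ ∣ᶠ + (∣ 𝒢 ∣ᶠ + (∣ 𝒰 ∣ᶠ + ∣ 𝒟 ∣ᶠ)) ≤ 2 ^ n
  crossSperner-card-bound
    -- The sum is folded from the inside out into the cardinality of one union.
    rewrite sym (card-∪-disjoint 𝒰 𝒟 disjoint-𝒰-𝒟)
          | sym (card-∪-disjoint 𝒢 (𝒰 ∪ᶠ 𝒟) (disjoint-∪ 𝒢 𝒰 𝒟 disjoint-𝒢-𝒰 disjoint-𝒢-𝒟))
          | sym (card-∪-disjoint ℱ (𝒢 ∪ᶠ 𝒰 ∪ᶠ 𝒟) (disjoint-∪ ℱ 𝒢 (𝒰 ∪ᶠ 𝒟) disjoint-ℱ-𝒢
                  (disjoint-∪ ℱ 𝒰 𝒟 disjoint-ℱ-𝒰 disjoint-ℱ-𝒟)))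
    = card≤2^n (ℱ ∪ᶠ 𝒢 ∪ᶠ 𝒰 ∪ᶠ 𝒟)

-- `ℱ` lies in both of its closures, and these are negatively correlated.
card≤up*down : (ℱ : Family n) → 2 ^ n * ∣ ℱ ∣ᶠ ≤ ∣ upClosure ℱ ∣ᶠ * ∣ downClosure ℱ ∣ᶠ
card≤up*down {n} ℱ = ≤-trans
  (*-monoʳ-≤ (2 ^ n) (card-mono {ℱ = ℱ} {upClosure ℱ ∩ᶠ downClosure ℱ}
    λ p → from T-∧ (⊆-upClosure ℱ p , ⊆-downClosure ℱ p)))
  (card-up∩down {𝒰 = upClosure ℱ} {downClosure ℱ} (upClosure-upClosed ℱ) (downClosure-downClosed ℱ))

-- The two up-closures are positively correlated; the size of the second is then weakened to that of
-- `𝒢`.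
up*card≤up∩up : (ℱ 𝒢 : Family n) →
  ∣ upClosure ℱ ∣ᶠ * ∣ 𝒢 ∣ᶠ ≤ 2 ^ n * ∣ upClosure ℱ ∩ᶠ upClosure 𝒢 ∣ᶠ
up*card≤up∩up ℱ 𝒢 = ≤-trans
  (*-monoʳ-≤ ∣ upClosure ℱ ∣ᶠ (card-mono {ℱ = 𝒢} {upClosure 𝒢} (⊆-upClosure 𝒢)))
  (card-up∩up (upClosure ℱ) (upClosure 𝒢) (upClosure-upClosed ℱ) (upClosure-upClosed 𝒢))

down*card≤down∩down : (ℱ 𝒢 : Family n) →
  ∣ downClosure ℱ ∣ᶠ * ∣ 𝒢 ∣ᶠ ≤ 2 ^ n * ∣ downClosure ℱ ∩ᶠ downClosure 𝒢 ∣ᶠ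
down*card≤down∩down ℱ 𝒢 = ≤-trans
  (*-monoʳ-≤ ∣ downClosure ℱ ∣ᶠ (card-mono {ℱ = 𝒢} {downClosure 𝒢} (⊆-downClosure 𝒢)))
  (card-down∩down (downClosure ℱ) (downClosure 𝒢) (downClosure-downClosed ℱ) (downClosure-downClosed 𝒢))

-- Numerical inequalities forcing the smaller family to be a singleton.

4*mn≤[m+n]² : ∀ m n → 4 * (m * n) ≤ (m + n) * (m + n)
4*mn≤[m+n]² m n with ≤-total m n
-- The sides differ by the square of the gap `k`; ordering the two numbers replaces subtraction.
... | inj₁ m≤n with k , refl ← m≤n⇒∃[o]m+o≡n m≤n =
  subst (4 * (m * (m + k)) ≤_) (sym (expand m k)) (m≤m+n _ (k * k))
  where
  expand : ∀ m k → (m + (m + k)) * (m + (m + k)) ≡ 4 * (m * (m + k)) + k * k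
  expand = solve-∀
... | inj₂ n≤m with k , refl ← m≤n⇒∃[o]m+o≡n n≤m =
  subst (4 * ((n + k) * n) ≤_) (sym (expand n k)) (m≤m+n _ (k * k))
  where
  expand : ∀ n k → ((n + k) + n) * ((n + k) + n) ≡ 4 * ((n + k) * n) + k * k
  expand = solve-∀

-- Here `u`, `d` stand for the sizes of the closures of `ℱ`, and `x`, `y` for the sizes of the
-- common up- and down-parts. AM-GM is applied to u g and d g, whose sum is at most N P; their
-- product controls N f g², and one factor N cancels.
8fg²≤9N² : ∀ {f g x y u d N P} → 0 < N →
  u * g ≤ N * x → d * g ≤ N * y → N * f ≤ u * d →
  x + y ≤ P → 2 * (P * P) ≤ 9 * N → 8 * (f * (g * g)) ≤ 9 * (N * N)
8fg²≤9N² {f} {g} {x} {y} {u} {d} {suc N-1} {P} _ ug≤Nx dg≤Ny Nf≤ud x+y≤P 2P²≤9N =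
  *-cancelˡ-≤ N (begin
    N * (8 * (f * (g * g)))                ≡⟨ e₁ N f g ⟩
    8 * ((N * f) * (g * g))                ≤⟨ *-monoʳ-≤ 8 (*-monoˡ-≤ (g * g) Nf≤ud) ⟩
    8 * ((u * d) * (g * g))                ≡⟨ e₂ u d g ⟩
    2 * (4 * ((u * g) * (d * g)))          ≤⟨ *-monoʳ-≤ 2 (4*mn≤[m+n]² (u * g) (d * g)) ⟩
    2 * ((u * g + d * g) * (u * g + d * g)) ≤⟨ *-monoʳ-≤ 2 (*-mono-≤ sum≤ sum≤) ⟩
    2 * ((N * P) * (N * P))                ≡⟨ e₃ N P ⟩
    N * N * (2 * (P * P))                  ≤⟨ *-monoʳ-≤ (N * N) 2P²≤9N ⟩
    N * N * (9 * N)                        ≡⟨ e₄ N ⟩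
    N * (9 * (N * N))                      ∎)
  where
  open ≤-Reasoning
  N = suc N-1
  sum≤ : u * g + d * g ≤ N * P
  sum≤ = begin
    u * g + d * g   ≤⟨ +-mono-≤ ug≤Nx dg≤Ny ⟩
    N * x + N * y   ≡⟨ *-distribˡ-+ N x y ⟨
    N * (x + y)     ≤⟨ *-monoʳ-≤ N x+y≤P ⟩
    N * P           ∎
  e₁ : ∀ N f g → N * (8 * (f * (g * g))) ≡ 8 * ((N * f) * (g * g))
  e₁ = solve-∀
  e₂ : ∀ u d g → 8 * ((u * d) * (g * g)) ≡ 2 * (4 * ((u * g) * (d * g)))
  e₂ = solve-∀
  e₃ : ∀ N P → 2 * ((N * P) * (N * P)) ≡ N * N * (2 * (P * P))
  e₃ = solve-∀
  e₄ : ∀ N → N * N * (9 * N) ≡ N * (9 * (N * N))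
  e₄ = solve-∀

-- A crude bound on f, which f≤1 bootstraps into g > 3N/4.
f≤8 : ∀ {f g N P} → f ≤ g → N ≤ f + g + P → 4 * P + 32 < N →
  8 * (f * (g * g)) ≤ 9 * (N * N) → f ≤ 8
f≤8 {f} {g} {N} {P} f≤g N≤f+g+P 4P+32<N bound = ≮⇒≥ λ 9≤f → <⇒≱ N²>0 (+-cancelˡ-≤ (8 * (N * N)) _ 0 (begin
    8 * (N * N) + N * N      ≡⟨ e₁ N ⟩
    3 * N * (3 * N)          ≤⟨ *-mono-≤ 3N≤8g 3N≤8g ⟩
    8 * g * (8 * g)          ≡⟨ e₂ g ⟩
    8 * (8 * (g * g))        ≤⟨ *-monoʳ-≤ 8 (*-cancelˡ-≤ {8 * (g * g)} {N * N} 9 (8g²≤N² 9≤f)) ⟩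
    8 * (N * N)              ≡⟨ +-identityʳ _ ⟨
    8 * (N * N) + 0          ∎))
  where
  open ≤-Reasoning
  N>0 : 0 < N
  N>0 = m<n⇒0<n 4P+32<N
  N²>0 : 0 < N * N
  N²>0 = *-mono-< N>0 N>0
  8g²≤N² : 9 ≤ f → 9 * (8 * (g * g)) ≤ 9 * (N * N)
  8g²≤N² 9≤f = begin
    9 * (8 * (g * g))    ≡⟨ e₃ (g * g) ⟩
    8 * (9 * (g * g))    ≤⟨ *-monoʳ-≤ 8 (*-monoˡ-≤ (g * g) 9≤f) ⟩
    8 * (f * (g * g))    ≤⟨ bound ⟩
    9 * (N * N)          ∎
    where
    e₃ : ∀ s → 9 * (8 * s) ≡ 8 * (9 * s)
    e₃ = solve-∀
  -- From f ≤ g follows N ≤ 2g + P, and in four times this inequality 4P is absorbed by one N. If f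
  -- were at least 9, then 8g² ≤ N² and so 9N² ≤ 64g² ≤ 8N².
  3N≤8g : 3 * N ≤ 8 * g
  3N≤8g = +-cancelʳ-≤ N _ _ (begin
    3 * N + N               ≡⟨ e₄ N ⟩
    4 * N                   ≤⟨ *-monoʳ-≤ 4 (≤-trans N≤f+g+P (+-monoˡ-≤ P (+-monoˡ-≤ g f≤g))) ⟩
    4 * (g + g + P)         ≡⟨ e₅ g P ⟩
    8 * g + 4 * P           ≤⟨ +-monoʳ-≤ (8 * g) (≤-trans (m≤m+n _ 32) (<⇒≤ 4P+32<N)) ⟩
    8 * g + N               ∎)
    where
    e₄ : ∀ N → 3 * N + N ≡ 4 * N
    e₄ = solve-∀
    e₅ : ∀ g P → 4 * (g + g + P) ≡ 8 * g + 4 * P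
    e₅ = solve-∀
  e₁ : ∀ N → 8 * (N * N) + N * N ≡ 3 * N * (3 * N)
  e₁ = solve-∀
  e₂ : ∀ g → 8 * g * (8 * g) ≡ 8 * (8 * (g * g))
  e₂ = solve-∀

-- Once f ≤ 8 is known, N ≤ 8 + g + P; the 32 in the hypothesis is 4 times this 8, which yields 3N <
-- 4g. Then f ≥ 2 would give 16g² ≤ 9N² < 16g².
f≤1 : ∀ {f g N P} → f ≤ g → N ≤ f + g + P → 4 * P + 32 < N →
  8 * (f * (g * g)) ≤ 9 * (N * N) → f ≤ 1
f≤1 {f} {g} {N} {P} f≤g N≤f+g+P 4P+32<N bound = ≮⇒≥ λ 2≤f → <-irrefl refl (begin-strict
  4 * g * (4 * g)        ≡⟨ e₁ g ⟩
  8 * (2 * (g * g))      ≤⟨ *-monoʳ-≤ 8 (*-monoˡ-≤ (g * g) 2≤f) ⟩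
  8 * (f * (g * g))      ≤⟨ bound ⟩
  9 * (N * N)            ≡⟨ e₂ N ⟩
  3 * N * (3 * N)        <⟨ *-mono-< 3N<4g 3N<4g ⟩
  4 * g * (4 * g)        ∎)
  where
  open ≤-Reasoning
  3N<4g : 3 * N < 4 * g
  3N<4g = +-cancelʳ-< N _ _ (begin-strict
    3 * N + N               ≡⟨ e₄ N ⟩
    4 * N                   ≤⟨ *-monoʳ-≤ 4 (≤-trans N≤f+g+P (+-monoˡ-≤ P (+-monoˡ-≤ g (f≤8 f≤g N≤f+g+P 4P+32<N bound)))) ⟩
    4 * (8 + g + P)         ≡⟨ e₅ g P ⟩
    4 * g + (4 * P + 32)    <⟨ +-monoʳ-< (4 * g) 4P+32<N ⟩
    4 * g + N               ∎)
    where
    e₄ : ∀ N → 3 * N + N ≡ 4 * N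
    e₄ = solve-∀
    e₅ : ∀ g P → 4 * (8 + g + P) ≡ 4 * g + (4 * P + 32)
    e₅ = solve-∀
  e₁ : ∀ g → 4 * g * (4 * g) ≡ 8 * (2 * (g * g))
  e₁ = solve-∀
  e₂ : ∀ N → 9 * (N * N) ≡ 3 * N * (3 * N)
  e₂ = solve-∀

-- Sums of two powers of two with complementary exponents.

⌈n/2⌉≡⌊n/2⌋⊎suc : ∀ n → ⌈ n /2⌉ ≡ ⌊ n /2⌋ ⊎ ⌈ n /2⌉ ≡ suc ⌊ n /2⌋
⌈n/2⌉≡⌊n/2⌋⊎suc zero          = inj₁ refl
⌈n/2⌉≡⌊n/2⌋⊎suc (suc zero)    = inj₂ refl
⌈n/2⌉≡⌊n/2⌋⊎suc (suc (suc n)) with ⌈n/2⌉≡⌊n/2⌋⊎suc n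
... | inj₁ eq = inj₁ (cong suc eq)
... | inj₂ eq = inj₂ (cong suc eq)

-- The P of the overview: the sets below and the sets above a middle set, which is itself counted
-- twice.
middlePowers : ℕ → ℕ
middlePowers n = 2 ^ ⌊ n /2⌋ + 2 ^ ⌈ n /2⌉

2^⌊n/2⌋*2^⌈n/2⌉≡2^n : ∀ n → 2 ^ ⌊ n /2⌋ * 2 ^ ⌈ n /2⌉ ≡ 2 ^ n
2^⌊n/2⌋*2^⌈n/2⌉≡2^n n = trans (sym (^-distribˡ-+-* 2 ⌊ n /2⌋ ⌈ n /2⌉)) (cong (2 ^_) (⌊n/2⌋+⌈n/2⌉≡n n))

-- For even `n`, P² = 4N. For odd `n`, P = 3x and N = 2x² with x = `2 ^ ⌊ n /2⌋`, so the constant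
-- 9/2 is attained.
2middlePowers²≤9*2^n : ∀ n → 2 * (middlePowers n * middlePowers n) ≤ 9 * 2 ^ n
2middlePowers²≤9*2^n n rewrite sym (2^⌊n/2⌋*2^⌈n/2⌉≡2^n n) with ⌈n/2⌉≡⌊n/2⌋⊎suc n
... | inj₁ eq rewrite eq = subst (2 * ((x + x) * (x + x)) ≤_) (sym (expand x)) (m≤m+n _ (x * x))
  where
  x = 2 ^ ⌊ n /2⌋
  expand : ∀ x → 9 * (x * x) ≡ 2 * ((x + x) * (x + x)) + x * x
  expand = solve-∀
... | inj₂ eq rewrite eq = ≤-reflexive (expand (2 ^ ⌊ n /2⌋))
  where
  expand : ∀ x → 2 * ((x + 2 * x) * (x + 2 * x)) ≡ 9 * (x * (2 * x))
  expand = solve-∀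

-- `n ≥ 10` makes both powers x ≤ y at least 32. The left side is then at most 9y, while N = x y.
4middlePowers+32<2^n : n ≥ 10 → 4 * middlePowers n + 32 < 2 ^ n
4middlePowers+32<2^n {n} n≥10 rewrite sym (2^⌊n/2⌋*2^⌈n/2⌉≡2^n n) = begin-strict
  4 * (x + y) + 32         ≤⟨ +-mono-≤ (*-monoʳ-≤ 4 (+-monoˡ-≤ y x≤y)) 32≤y ⟩
  4 * (y + y) + y          ≡⟨ expand y ⟩
  9 * y                    <⟨ *-monoˡ-< y {{m^n≢0 2 ⌈ n /2⌉}} (≤-trans (m≤m+n 10 22) 32≤x) ⟩
  x * y                    ∎
  where
  open ≤-Reasoning
  x = 2 ^ ⌊ n /2⌋
  y = 2 ^ ⌈ n /2⌉
  x≤y : x ≤ y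
  x≤y = ^-monoʳ-≤ 2 (⌊n/2⌋≤⌈n/2⌉ n)
  32≤x : 32 ≤ x
  32≤x = ^-monoʳ-≤ 2 (⌊n/2⌋-mono n≥10)
  32≤y : 32 ≤ y
  32≤y = ≤-trans 32≤x x≤y
  expand : ∀ y → 4 * (y + y) + y ≡ 9 * y
  expand = solve-∀

-- Raising the larger exponent by one doubles its power, which already pays for both terms;
-- positivity of `2 ^ t` makes the inequality strict.
2^-unbalanced : ∀ {a b s} t → b ≤ a → a < s → 2 ^ b + 2 ^ a < 2 ^ s + 2 ^ t
2^-unbalanced {a} {b} {s} t b≤a a<s = begin-strict
  2 ^ b + 2 ^ a        ≤⟨ +-monoˡ-≤ (2 ^ a) (^-monoʳ-≤ 2 b≤a) ⟩
  2 ^ a + 2 ^ a        ≡⟨ cong (2 ^ a +_) (+-identityʳ (2 ^ a)) ⟨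
  2 ^ suc a            ≤⟨ ^-monoʳ-≤ 2 a<s ⟩
  2 ^ s                <⟨ m<m+n (2 ^ s) (m^n>0 2 t) ⟩
  2 ^ s + 2 ^ t        ∎
  where open ≤-Reasoning

2^-balanced : ∀ {n s t} → s + t ≡ n →
  middlePowers n < 2 ^ s + 2 ^ t ⊎ (s ≡ ⌊ n /2⌋ ⊎ s ≡ ⌈ n /2⌉)
2^-balanced {n} {s} {t} s+t≡n with <-cmp s ⌊ n /2⌋ | <-cmp s ⌈ n /2⌉
-- If `s` is below ⌊n/2⌋, then `t` exceeds ⌈n/2⌉ and is the large exponent.
... | tri< s<b _ _ | _            = inj₁ (subst (middlePowers n <_) (+-comm (2 ^ t) (2 ^ s))
  (2^-unbalanced s (⌊n/2⌋≤⌈n/2⌉ n) (≰⇒> λ t≤a → <-irrefl (trans s+t≡n (sym (⌊n/2⌋+⌈n/2⌉≡n n))) (+-mono-<-≤ s<b t≤a))))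
... | tri≈ _ s≡b _ | _            = inj₂ (inj₁ s≡b)
... | tri> _ _ b<s | tri≈ _ s≡a _ = inj₂ (inj₂ s≡a)
... | tri> _ _ b<s | tri> _ _ a<s = inj₁ (2^-unbalanced t (⌊n/2⌋≤⌈n/2⌉ n) a<s)
-- Floor and ceiling differ by at most one, so no exponent lies strictly between them.
... | tri> _ _ b<s | tri< s<a _ _ = contradiction (≤-trans s<a a≤1+b) (<⇒≱ (s≤s b<s))
  where
  a≤1+b : ⌈ n /2⌉ ≤ suc ⌊ n /2⌋
  a≤1+b = [ (λ eq → m≤n⇒m≤1+n (≤-reflexive eq)) , ≤-reflexive ]′ (⌈n/2⌉≡⌊n/2⌋⊎suc n)

2^-middle : ∀ {n s t} → s + t ≡ n → s ≡ ⌊ n /2⌋ ⊎ s ≡ ⌈ n /2⌉ → 2 ^ s + 2 ^ t ≡ middlePowers n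
2^-middle {n} {s} {t} s+t≡n (inj₁ refl) =
  cong (λ k → 2 ^ s + 2 ^ k) (+-cancelˡ-≡ s t _ (trans s+t≡n (sym (⌊n/2⌋+⌈n/2⌉≡n n))))
2^-middle {n} {s} {t} s+t≡n (inj₂ refl) = trans (+-comm (2 ^ s) (2 ^ t))
  (cong (λ k → 2 ^ k + 2 ^ s) (+-cancelʳ-≡ s t _ (trans (+-comm t s) (trans s+t≡n (sym (⌊n/2⌋+⌈n/2⌉≡n n))))))

-- One family of a large pair is a singleton.

private
  smaller≡1 : n ≥ 10 → (ℱ 𝒢 : Family n) → NonemptyFamily ℱ → CrossSperner ℱ 𝒢 →
    2 ^ n ≤ ∣ ℱ ∣ᶠ + ∣ 𝒢 ∣ᶠ + middlePowers n → ∣ ℱ ∣ᶠ ≤ ∣ 𝒢 ∣ᶠ → ∣ ℱ ∣ᶠ ≡ 1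
  smaller≡1 {n} n≥10 ℱ 𝒢 ne sep large f≤g = ≤-antisym
    (f≤1 f≤g large 4P+32<N
      (8fg²≤9N² {g = ∣ 𝒢 ∣ᶠ} {u = ∣ upClosure ℱ ∣ᶠ} {∣ downClosure ℱ ∣ᶠ} (m<n⇒0<n 4P+32<N) (up*card≤up∩up ℱ 𝒢) (down*card≤down∩down ℱ 𝒢) (card≤up*down ℱ)
        few (2middlePowers²≤9*2^n n)))
    (nonempty⇒card>0 ℱ ne)
    where
    4P+32<N = 4middlePowers+32<2^n n≥10
    -- The pair leaves at most P sets over, and the common up- and down-parts must fit among them.
    few = +-cancelˡ-≤ (∣ ℱ ∣ᶠ + ∣ 𝒢 ∣ᶠ) _ (middlePowers n)
      (≤-trans (≤-reflexive (+-assoc ∣ ℱ ∣ᶠ _ _)) (≤-trans (crossSperner-card-bound ℱ 𝒢 sep) large))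

large⇒singleton : n ≥ 10 → (ℱ 𝒢 : Family n) → NonemptyFamily ℱ → NonemptyFamily 𝒢 →
  CrossSperner ℱ 𝒢 → 2 ^ n ≤ ∣ ℱ ∣ᶠ + ∣ 𝒢 ∣ᶠ + middlePowers n → ∣ ℱ ∣ᶠ ≡ 1 ⊎ ∣ 𝒢 ∣ᶠ ≡ 1
large⇒singleton {n} n≥10 ℱ 𝒢 neℱ ne𝒢 sep large with ≤-total ∣ ℱ ∣ᶠ ∣ 𝒢 ∣ᶠ
... | inj₁ f≤g = inj₁ (smaller≡1 n≥10 ℱ 𝒢 neℱ sep large f≤g)
... | inj₂ g≤f = inj₂ (smaller≡1 n≥10 𝒢 ℱ ne𝒢 (crossSperner-sym {ℱ = ℱ} {𝒢} sep)
  (subst (λ k → 2 ^ n ≤ k + middlePowers n) (+-comm ∣ ℱ ∣ᶠ _) large) g≤f)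

-- Sets comparable and incomparable to a fixed set.

T-does⁺ : ∀ {A : Set} (A? : Dec A) → A → T (does A?)
T-does⁺ (yes _) _ = _
T-does⁺ (no ¬a) a = ¬a a

T-does⁻ : ∀ {A : Set} (A? : Dec A) → T (does A?) → A
T-does⁻ (yes a) _ = a

-- Unlike ⌊_⌋, does lets these families reduce definitionally on x ∷ A.
below above singleton incomparables : Subset n → Family n
below S A = does (A ⊆? S)
above S A = does (S ⊆? A)
singleton S A = does (≡-dec Bool._≟_ A S)
incomparables S = ∁ᶠ (below S ∪ᶠ above S)

∈-below⁺ : {S A : Subset n} → A ⊆ S → A ∈ᶠ below S
∈-below⁺ {S = S} {A} = T-does⁺ (A ⊆? S)

∈-below⁻ : {S A : Subset n} → A ∈ᶠ below S → A ⊆ S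
∈-below⁻ {S = S} {A} = T-does⁻ (A ⊆? S)

∈-above⁺ : {S A : Subset n} → S ⊆ A → A ∈ᶠ above S
∈-above⁺ {S = S} {A} = T-does⁺ (S ⊆? A)

∈-above⁻ : {S A : Subset n} → A ∈ᶠ above S → S ⊆ A
∈-above⁻ {S = S} {A} = T-does⁻ (S ⊆? A)

∈-singleton : (S A : Subset n) → A ∈ᶠ singleton S ⇔ A ≡ S
∈-singleton S A = mk⇔ (T-does⁻ (≡-dec Bool._≟_ A S)) (T-does⁺ (≡-dec Bool._≟_ A S))

card-below : (S : Subset n) → ∣ below S ∣ᶠ ≡ 2 ^ ∣ S ∣
card-below []            = refl
card-below {suc n} (outside ∷ S) = trans (card-suc (below (outside ∷ S)))
  (trans (cong₂ _+_ (card-below S) (card-empty {n})) (+-identityʳ _))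
card-below (inside ∷ S)  = trans (card-suc (below (inside ∷ S)))
  (cong₂ _+_ (card-below S) (trans (card-below S) (sym (+-identityʳ _))))

card-above : (S : Subset n) → ∣ above S ∣ᶠ ≡ 2 ^ ∣ ∁ S ∣
card-above []            = refl
card-above (outside ∷ S) = trans (card-suc (above (outside ∷ S)))
  (cong₂ _+_ (card-above S) (trans (card-above S) (sym (+-identityʳ _))))
card-above {suc n} (inside ∷ S)  = trans (card-suc (above (inside ∷ S)))
  (cong₂ _+_ (card-empty {n}) (card-above S))

card-singleton : (S : Subset n) → ∣ singleton S ∣ᶠ ≡ 1
card-singleton []            = refl
card-singleton {suc n} (outside ∷ S) = trans (card-suc (singleton (outside ∷ S)))
  (cong₂ _+_ (card-singleton S) (card-empty {n}))
card-singleton {suc n} (inside ∷ S)  = trans (card-suc (singleton (inside ∷ S)))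
  (cong₂ _+_ (card-empty {n}) (card-singleton S))

-- By antisymmetry, the sets below and the sets above `S` share only `S`; this overlap is the 1 on
-- the right.
card-incomparables : (S : Subset n) →
  ∣ incomparables S ∣ᶠ + (2 ^ ∣ S ∣ + 2 ^ ∣ ∁ S ∣) ≡ 2 ^ n + 1
card-incomparables {n} S = begin-equality
  i + (2 ^ ∣ S ∣ + 2 ^ ∣ ∁ S ∣)     ≡⟨ cong (i +_) (cong₂ _+_ (card-below S) (card-above S)) ⟨
  i + (∣ below S ∣ᶠ + ∣ above S ∣ᶠ)  ≡⟨ cong (i +_) (card-∪+card-∩ (below S) (above S)) ⟨
  i + (c + ∣ below S ∩ᶠ above S ∣ᶠ)  ≡⟨ cong (λ k → i + (c + k)) below∩above≡1 ⟩
  i + (c + 1)                        ≡⟨ +-assoc i c 1 ⟨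
  i + c + 1                          ≡⟨ cong (_+ 1) (trans (+-comm i c) (card-+-∁ (below S ∪ᶠ above S))) ⟩
  2 ^ n + 1                          ∎
  where
  open ≤-Reasoning
  i = ∣ incomparables S ∣ᶠ
  c = ∣ below S ∪ᶠ above S ∣ᶠ
  ⊆-single : ∀ {A} → A ∈ᶠ below S ∩ᶠ above S → A ∈ᶠ singleton S
  ⊆-single {A} p with l , r ← to T-∧ p =
    from (∈-singleton S A) (⊆-antisym (∈-below⁻ {S = S} {A} l) (∈-above⁻ {S = S} {A} r))
  single-⊆ : ∀ {A} → A ∈ᶠ singleton S → A ∈ᶠ below S ∩ᶠ above S
  single-⊆ {A} p with refl ← to (∈-singleton S A) p =
    from T-∧ (∈-below⁺ {S = S} {S} (⊆-refl {x = S}) , ∈-above⁺ {S = S} {S} (⊆-refl {x = S}))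
  below∩above≡1 : ∣ below S ∩ᶠ above S ∣ᶠ ≡ 1
  below∩above≡1 = trans (card-cong {ℱ = below S ∩ᶠ above S} {singleton S} ⊆-single single-⊆) (card-singleton S)

∈-incomparables⁺ : (S A : Subset n) → A ⊈ S → S ⊈ A → A ∈ᶠ incomparables S
∈-incomparables⁺ S A A⊈S S⊈A = ∈-∁ᶠ⁺ (below S ∪ᶠ above S) λ p →
  [ A⊈S ∘ ∈-below⁻ , S⊈A ∘ ∈-above⁻ ]′ (to (T-∨ {below S A}) p)

∈-incomparables⁻ : (S A : Subset n) → A ∈ᶠ incomparables S → A ⊈ S × S ⊈ A
∈-incomparables⁻ S A p = A⊈S , S⊈A
  where
  A⊈S : A ⊈ S
  A⊈S A⊆S = ∈-∁ᶠ⁻ (below S ∪ᶠ above S) p (from T-∨ (inj₁ (∈-below⁺ {S = S} {A} A⊆S)))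
  S⊈A : S ⊈ A
  S⊈A S⊆A = ∈-∁ᶠ⁻ (below S ∪ᶠ above S) p (from (T-∨ {below S A}) (inj₂ (∈-above⁺ {S = S} {A} S⊆A)))

-- Makes `incomparables S` an upper bound for every partner of a family containing `S`.
crossSperner⇒⊆incomparables : (ℱ 𝒢 : Family n) → CrossSperner ℱ 𝒢 →
  ∀ {S} → S ∈ᶠ ℱ → 𝒢 ⊆ᶠ incomparables S
crossSperner⇒⊆incomparables ℱ 𝒢 sep {S} S∈ℱ {A} A∈𝒢 = ∈-incomparables⁺ S A
  (λ A⊆S → sep (S , A , S∈ℱ , A∈𝒢 , inj₂ A⊆S)) (λ S⊆A → sep (S , A , S∈ℱ , A∈𝒢 , inj₁ S⊆A))

singleton-crossSperner : (S : Subset n) → CrossSperner (singleton S) (incomparables S)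
singleton-crossSperner S (A , B , A∈ , B∈ , cmp)
  with refl ← to (∈-singleton S A) A∈ =
  [ proj₂ (∈-incomparables⁻ S B B∈) , proj₁ (∈-incomparables⁻ S B B∈) ]′ cmp

-- A member of `𝒢` missing from `ℱ` could be added to `ℱ` without leaving `𝒢`, which has no room for
-- it. In the equality case this turns equal sizes into equal families.
⊆∧card≥⇒⊇ : (ℱ 𝒢 : Family n) → ℱ ⊆ᶠ 𝒢 → ∣ 𝒢 ∣ᶠ ≤ ∣ ℱ ∣ᶠ → 𝒢 ⊆ᶠ ℱ
⊆∧card≥⇒⊇ ℱ 𝒢 ℱ⊆𝒢 g≤f {A} A∈𝒢 with T? (ℱ A)
... | yes A∈ℱ = A∈ℱ
... | no  A∉ℱ = contradiction (≤-trans f+1≤g g≤f) (m+1+n≰m ∣ ℱ ∣ᶠ)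
  where
  disjoint : Disjoint ℱ (singleton A)
  disjoint {B} B∈ℱ B∈A with refl ← to (∈-singleton A B) B∈A = A∉ℱ B∈ℱ
  ∪⊆𝒢 : (ℱ ∪ᶠ singleton A) ⊆ᶠ 𝒢
  ∪⊆𝒢 {B} p with to (T-∨ {ℱ B}) p
  ... | inj₁ B∈ℱ = ℱ⊆𝒢 B∈ℱ
  ... | inj₂ B∈A with refl ← to (∈-singleton A B) B∈A = A∈𝒢
  f+1≤g : ∣ ℱ ∣ᶠ + 1 ≤ ∣ 𝒢 ∣ᶠ
  f+1≤g = subst (_≤ ∣ 𝒢 ∣ᶠ)
    (trans (card-∪-disjoint ℱ (singleton A) disjoint) (cong (∣ ℱ ∣ᶠ +_) (card-singleton A)))
    (card-mono {ℱ = ℱ ∪ᶠ singleton A} {𝒢} ∪⊆𝒢)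

card≡1⇒∈⇔≡ : (ℱ : Family n) → ∣ ℱ ∣ᶠ ≡ 1 → ∀ {S} → S ∈ᶠ ℱ → ∀ A → A ∈ᶠ ℱ ⇔ A ≡ S
card≡1⇒∈⇔≡ ℱ f≡1 {S} S∈ℱ A = mk⇔
  (λ A∈ℱ → to (∈-singleton S A) (⊆∧card≥⇒⊇ (singleton S) ℱ singleton⊆ (≤-reflexive (trans f≡1 (sym (card-singleton S)))) A∈ℱ))
  (λ { refl → S∈ℱ })
  where
  singleton⊆ : singleton S ⊆ᶠ ℱ
  singleton⊆ {B} p with refl ← to (∈-singleton S B) p = S∈ℱ

-- Middle sets and the optimal partner of a singleton.

subsetOfSize : ∀ {n k} → k ≤ n → ∃ λ (S : Subset n) → ∣ S ∣ ≡ k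
subsetOfSize {n} z≤n       = ⊥ , ∣⊥∣≡0 n
subsetOfSize     (s≤s k≤n) with S , eq ← subsetOfSize k≤n = inside ∷ S , cong suc eq

∣S∣+∣∁S∣≡n : (S : Subset n) → ∣ S ∣ + ∣ ∁ S ∣ ≡ n
∣S∣+∣∁S∣≡n S = trans (cong (∣ S ∣ +_) (∣∁p∣≡n∸∣p∣ S)) (m+[n∸m]≡n (∣p∣≤n S))

IsMiddle : Subset n → Set
IsMiddle {n} S = ∣ S ∣ ≡ ⌊ n /2⌋ ⊎ ∣ S ∣ ≡ ⌈ n /2⌉

middle-card : {S : Subset n} → IsMiddle S → ∣ incomparables S ∣ᶠ + middlePowers n ≡ 2 ^ n + 1
middle-card {S = S} mid = trans
  (cong (∣ incomparables S ∣ᶠ +_) (sym (2^-middle (∣S∣+∣∁S∣≡n S) mid))) (card-incomparables S)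

-- The hypothesis fixes `f` as the value for a middle set, without subtraction. Away from the
-- middle, `2^-balanced` gives more comparable sets, hence fewer incomparable ones.
incomparables-<⊎middle : ∀ {f} → f + middlePowers n ≡ 2 ^ n + 1 →
  (S : Subset n) → ∣ incomparables S ∣ᶠ < f ⊎ IsMiddle S
incomparables-<⊎middle {n} {f} f+P S with 2^-balanced (∣S∣+∣∁S∣≡n S)
... | inj₂ mid = inj₂ mid
... | inj₁ lt  = inj₁ (+-cancelʳ-< (middlePowers n) _ _ (begin-strict
  ∣ incomparables S ∣ᶠ + middlePowers n               <⟨ +-monoʳ-< ∣ incomparables S ∣ᶠ lt ⟩
  ∣ incomparables S ∣ᶠ + (2 ^ ∣ S ∣ + 2 ^ ∣ ∁ S ∣)    ≡⟨ card-incomparables S ⟩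
  2 ^ n + 1                                           ≡⟨ f+P ⟨
  f + middlePowers n                                  ∎))
  where open ≤-Reasoning

incomparables-≤ : ∀ {f} → f + middlePowers n ≡ 2 ^ n + 1 →
  (S : Subset n) → ∣ incomparables S ∣ᶠ ≤ f
incomparables-≤ {n} f+P S with incomparables-<⊎middle f+P S
... | inj₁ lt  = <⇒≤ lt
... | inj₂ mid = ≤-reflexive (+-cancelʳ-≡ (middlePowers n) _ _ (trans (middle-card {S = S} mid) (sym f+P)))

module _ {f} (f+P : f + middlePowers n ≡ 2 ^ n + 1) (ℱ 𝒢 : Family n) where

  singleton-bound : ∣ ℱ ∣ᶠ ≡ 1 → CrossSperner ℱ 𝒢 → ∣ 𝒢 ∣ᶠ ≤ f
  singleton-bound f≡1 sep with S , S∈ℱ ← card>0⇒nonempty ℱ (≤-reflexive (sym f≡1)) =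
    ≤-trans (card-mono {ℱ = 𝒢} {incomparables S} (crossSperner⇒⊆incomparables ℱ 𝒢 sep S∈ℱ))
      (incomparables-≤ f+P S)

  -- `𝒢` has `f` members, all incomparable to `S`, and no set has more than `f` incomparable ones.
  -- So `𝒢` takes all of them, and `S` cannot be off the middle.
  singleton-extremal : ∣ ℱ ∣ᶠ ≡ 1 → CrossSperner ℱ 𝒢 → ∣ 𝒢 ∣ᶠ ≡ f → MiddleSetAndIncomparables ℱ 𝒢
  singleton-extremal f≡1 sep g≡f with S , S∈ℱ ← card>0⇒nonempty ℱ (≤-reflexive (sym f≡1)) =
    S , middle , card≡1⇒∈⇔≡ ℱ f≡1 S∈ℱ , λ B → mk⇔
      (λ B∈𝒢 → ∈-incomparables⁻ S B (𝒢⊆ B∈𝒢))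
      (λ inc → ⊆∧card≥⇒⊇ 𝒢 (incomparables S) 𝒢⊆
        (≤-trans (incomparables-≤ f+P S) (≤-reflexive (sym g≡f))) (∈-incomparables⁺ S B (proj₁ inc) (proj₂ inc)))
    where
    𝒢⊆ : 𝒢 ⊆ᶠ incomparables S
    𝒢⊆ = crossSperner⇒⊆incomparables ℱ 𝒢 sep S∈ℱ
    middle : IsMiddle S
    middle with incomparables-<⊎middle f+P S
    ... | inj₂ mid = mid
    ... | inj₁ lt  = contradiction
      (≤-trans (≤-reflexive (sym g≡f)) (card-mono {ℱ = 𝒢} {incomparables S} 𝒢⊆)) (<⇒≱ lt)

  middle⇒card-sum : MiddleSetAndIncomparables ℱ 𝒢 → ∣ ℱ ∣ᶠ + ∣ 𝒢 ∣ᶠ ≡ f + 1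
  middle⇒card-sum (S , mid , ℱ≡ , 𝒢≡) = trans (cong₂ _+_ f≡1 g≡f) (+-comm 1 f)
    where
    f≡1 : ∣ ℱ ∣ᶠ ≡ 1
    f≡1 = trans (card-cong {ℱ = ℱ} {singleton S}
      (λ {A} p → from (∈-singleton S A) (to (ℱ≡ A) p)) (λ {A} p → from (ℱ≡ A) (to (∈-singleton S A) p))) (card-singleton S)
    g≡f : ∣ 𝒢 ∣ᶠ ≡ f
    g≡f = trans (card-cong {ℱ = 𝒢} {incomparables S}
      (λ {A} p → ∈-incomparables⁺ S A (proj₁ (to (𝒢≡ A) p)) (proj₂ (to (𝒢≡ A) p)))
      (λ {A} p → from (𝒢≡ A) (∈-incomparables⁻ S A p)))
      (+-cancelʳ-≡ (middlePowers n) _ _ (trans (middle-card {S = S} mid) (sym f+P)))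

-- The upper bound and its equality case.

module _ {f} (n≥10 : n ≥ 10) (f+P : f + middlePowers n ≡ 2 ^ n + 1) (ℱ 𝒢 : Family n)
  (neℱ : NonemptyFamily ℱ) (ne𝒢 : NonemptyFamily 𝒢) (sep : CrossSperner ℱ 𝒢) where

  private
    -- As f + P = N + 1, a pair reaching f + 1 meets the size condition of `large⇒singleton`.
    sum≥⇒singleton : f + 1 ≤ ∣ ℱ ∣ᶠ + ∣ 𝒢 ∣ᶠ → ∣ ℱ ∣ᶠ ≡ 1 ⊎ ∣ 𝒢 ∣ᶠ ≡ 1
    sum≥⇒singleton large = large⇒singleton n≥10 ℱ 𝒢 neℱ ne𝒢 sep (begin
      2 ^ n                                 ≤⟨ m≤m+n (2 ^ n) 1 ⟩
      2 ^ n + 1                             ≡⟨ f+P ⟨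
      f + middlePowers n                    ≤⟨ +-monoˡ-≤ (middlePowers n) (≤-trans (m≤m+n f 1) large) ⟩
      ∣ ℱ ∣ᶠ + ∣ 𝒢 ∣ᶠ + middlePowers n      ∎)
      where open ≤-Reasoning

    sep′ : CrossSperner 𝒢 ℱ
    sep′ = crossSperner-sym {ℱ = ℱ} {𝒢} sep

  card-sum≤ : ∣ ℱ ∣ᶠ + ∣ 𝒢 ∣ᶠ ≤ f + 1
  card-sum≤ with ≤-total (∣ ℱ ∣ᶠ + ∣ 𝒢 ∣ᶠ) (f + 1)
  ... | inj₁ le    = le
  -- A pair reaching f + 1 contains a singleton, and the other family then has at most `f` members.
  ... | inj₂ large with sum≥⇒singleton large
  ...   | inj₁ f≡1 = subst (_≤ f + 1) (+-comm ∣ 𝒢 ∣ᶠ _)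
    (+-mono-≤ (singleton-bound f+P ℱ 𝒢 f≡1 sep) (≤-reflexive f≡1))
  ...   | inj₂ g≡1 = +-mono-≤ (singleton-bound f+P 𝒢 ℱ g≡1 sep′) (≤-reflexive g≡1)

  card-sum≡⇒middle : ∣ ℱ ∣ᶠ + ∣ 𝒢 ∣ᶠ ≡ f + 1 →
    MiddleSetAndIncomparables ℱ 𝒢 ⊎ MiddleSetAndIncomparables 𝒢 ℱ
  card-sum≡⇒middle eq with sum≥⇒singleton (≤-reflexive (sym eq))
  ... | inj₁ f≡1 = inj₁ (singleton-extremal f+P ℱ 𝒢 f≡1 sep
    (+-cancelˡ-≡ 1 _ f (trans (cong (_+ ∣ 𝒢 ∣ᶠ) (sym f≡1)) (trans eq (+-comm f 1)))))
  ... | inj₂ g≡1 = inj₂ (singleton-extremal f+P 𝒢 ℱ g≡1 sep′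
    (+-cancelʳ-≡ 1 _ f (trans (cong (∣ ℱ ∣ᶠ +_) (sym g≡1)) eq)))

-- The closed formula and the final assembly.

open ℤ using (+_)

-- Integers make the subtractions of the closed formula genuine. Adding and subtracting x + y
-- exposes the sum that the hypothesis evaluates.
f+1≡2^n-2^a-2^b+2 : ∀ f N x y → f + (y + x) ≡ N + 1 → + (f + 1) ≡ + N ℤ.- + x ℤ.- + y ℤ.+ + 2
f+1≡2^n-2^a-2^b+2 f N x y eq = trans (e₁ (+ f) (+ x) (+ y))
  (trans (cong (λ z → z ℤ.- + x ℤ.- + y ℤ.+ + 1) (cong +_ eq)) (e₂ (+ N) (+ x) (+ y)))
  where
  e₁ : ∀ f x y → f ℤ.+ + 1 ≡ f ℤ.+ (y ℤ.+ x) ℤ.- x ℤ.- y ℤ.+ + 1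
  e₁ = ℤ-Solver.solve-∀
  e₂ : ∀ N x y → N ℤ.+ + 1 ℤ.- x ℤ.- y ℤ.+ + 1 ≡ N ℤ.- x ℤ.- y ℤ.+ + 2
  e₂ = ℤ-Solver.solve-∀

theorem1p1 : ∃ λ (n₀ : ℕ) → ∀ (n : ℕ) → n ≥ n₀ →
    ∃ λ (f : ℕ) → IsF n 1 f ×
    + (f + 1) ≡ + (2 ^ n) ℤ.- + (2 ^ ⌈ n /2⌉) ℤ.- + (2 ^ ⌊ n /2⌋) ℤ.+ + 2 ×
    (∀ (ℱ 𝒢 : Family n) → NonemptyFamily ℱ → NonemptyFamily 𝒢 → CrossSperner ℱ 𝒢 →
    ∣ ℱ ∣ᶠ + ∣ 𝒢 ∣ᶠ ≤ f + 1 ×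
    (∣ ℱ ∣ᶠ + ∣ 𝒢 ∣ᶠ ≡ f + 1 ⇔
    (MiddleSetAndIncomparables ℱ 𝒢 ⊎ MiddleSetAndIncomparables 𝒢 ℱ)))
theorem1p1 = 10 , λ n n≥10 →
  -- Any set of size ⌊n/2⌋ attains the maximum, so `f` is taken to be the number of sets
  -- incomparable to it.
  let S , ∣S∣≡⌊n/2⌋ = subsetOfSize (⌊n/2⌋≤n n)
      f   = ∣ incomparables S ∣ᶠ
      f+P = middle-card {S = S} (inj₁ ∣S∣≡⌊n/2⌋)
  in f
   , ( (incomparables S , refl , singleton S , card-singleton S , singleton-crossSperner S)
     , λ { j (𝒢 , refl , ℱ , f≡1 , sep) → singleton-bound f+P ℱ 𝒢 f≡1 sep } )
   , f+1≡2^n-2^a-2^b+2 f (2 ^ n) (2 ^ ⌈ n /2⌉) (2 ^ ⌊ n /2⌋) f+P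
   , λ ℱ 𝒢 neℱ ne𝒢 sep →
       card-sum≤ n≥10 f+P ℱ 𝒢 neℱ ne𝒢 sep
     , mk⇔ (card-sum≡⇒middle n≥10 f+P ℱ 𝒢 neℱ ne𝒢 sep)
           [ middle⇒card-sum f+P ℱ 𝒢
           , (λ mid → trans (+-comm ∣ ℱ ∣ᶠ _) (middle⇒card-sum f+P 𝒢 ℱ mid)) ]′
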